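{- For each $s \geq 1$ and $n \geq 4$, we have $$R(\mathcal{P}_n^{2s,s},\mathcal{P}_4^{2s,s})=(n+1)s+1.$$
   Context: An $r$-uniform hypergraph $H=(V,E)$ consists of a vertex set $V$ and a collection $E$ of $r$-subsets of $V$; $K_N^r$ denotes the complete $r$-uniform hypergraph on $N$ vertices. For $r$-uniform hypergraphs $H_1,H_2$, the Ramsey number $R(H_1,H_2)$ is the minimum $N$ such that each red-blue coloring of the edges of $K_N^r$ contains either a red copy of $H_1$ or a blue copy of $H_2$. For integers $s,n\ge 1$, the path $\mathcal{P}_n^{2s,s}$ of length $n$ is the $2s$-uniform hypergraph on distinct vertices $v_1,v_2,\ldots,v_{(n+1)s}$ whose $n$ edges are $\{v_{1+is},\ldots,v_{(i+2)s}\}$ for $0\le i\le n-1$. Equivalently, it is given by pairwise disjoint $s$-sets $A_1,\ldots,A_{n+1}$ with edges $A_i\cup A_{i+1}$ for $1\le i\le n$. -}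

module Defs where

open import Data.Empty using (⊥-elim)
open import Data.Fin using (Fin; zero; suc; toℕ)
open import Data.Fin.Properties using (any?; _≟_; toℕ<n)
open import Data.Fin.Subset using (Subset; _∈_; ∣_∣)
open import Data.Fin.Subset.Properties using (_∈?_)
open import Data.Nat using (ℕ; zero; suc; _+_; _*_; _≤_; _<_; z≤n; s≤s; s≤s⁻¹; _≤?_; _<?_)
open import Data.Nat.Properties using (≤-trans; ≤-reflexive; *-monoˡ-≤; *-distribʳ-+; +-monoˡ-≤; +-suc; n≮0)
open import Data.Product using (Σ; ∃-syntax; _×_; _,_; proj₁; proj₂; map₂)
open import Data.Sum using (_⊎_)
open import Data.Vec using (tabulate)
open import Function using (_∘_)
open import Function.Bundles using (_⇔_; mk⇔; Equivalence)
open import Function.Definitions using (Injective)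
open import Level using (0ℓ)
open import Relation.Binary.PropositionalEquality using (_≡_; refl; sym; trans; cong; subst)
open import Relation.Nullary using (yes; no; does)
open import Relation.Nullary.Decidable using (_×-dec_)
open import Relation.Unary using (Pred; Decidable)

⟦_⟧ : ∀ {N} {P : Pred (Fin N) 0ℓ} → Decidable P → Subset N
⟦ P? ⟧ = tabulate (does ∘ P?)

image : ∀ {M N} → (Fin M → Fin N) → Subset M → Subset N
image f p = ⟦ (λ y → any? (λ x → (x ∈? p) ×-dec (f x ≟ y))) ⟧

-- Finite hypergraphs, with vertex set Fin vertices.
record Hypergraph (r : ℕ) : Set₁ where
  field
    vertices : ℕ
    Edge     : Pred (Subset vertices) 0ℓ
    uniform  : ∀ {e} → Edge e → ∣ e ∣ ≡ r

open Hypergraph public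

complete : (r N : ℕ) → Hypergraph r
complete r N = record
  { vertices = N
  ; Edge     = λ e → ∣ e ∣ ≡ r
  ; uniform  = λ ∣e∣≡r → ∣e∣≡r
  }

-- A copy of H in G is a not necessarily induced subhypergraph of G
-- isomorphic to H.
record Copy {r} (H G : Hypergraph r) : Set where
  field
    embed     : Fin (vertices H) → Fin (vertices G)
    injective : Injective _≡_ _≡_ embed
    edges     : ∀ {e} → Edge H e → Edge G (image embed e)

data Colour : Set where
  red blue : Colour

Colouring : ∀ {r} → Hypergraph r → Set
Colouring G = ∀ e → Edge G e → Colour

colourClass : ∀ {r} (G : Hypergraph r) → Colouring G → Colour → Hypergraph r
colourClass G χ c = record
  { vertices = vertices G
  ; Edge     = λ e → Σ (Edge G e) λ e∈G → χ e e∈G ≡ c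
  ; uniform  = λ (e∈G , _) → uniform G e∈G
  }

Arrows : ∀ {r} → ℕ → Hypergraph r → Hypergraph r → Set
Arrows {r} N H₁ H₂ = (χ : Colouring (complete r N)) →
  Copy H₁ (colourClass (complete r N) χ red) ⊎
  Copy H₂ (colourClass (complete r N) χ blue)

-- R(H₁ , H₂) = N.
RamseyNumber : ∀ {r} → Hypergraph r → Hypergraph r → ℕ → Set
RamseyNumber H₁ H₂ N = Arrows N H₁ H₂ × (∀ M → Arrows M H₁ H₂ → N ≤ M)

-- With v₁ , v₂ , … numbered from 0, the block {v_{1+is} , … , v_{(i+2)s}}
-- consists of the vertices in the half-open interval [ i s , (i + 2) s ).
InBlock : (s n : ℕ) → Fin n → Pred (Fin ((n + 1) * s)) 0ℓ
InBlock s n i v = toℕ i * s ≤ toℕ v × toℕ v < (toℕ i + 2) * s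

inBlock? : ∀ s n i → Decidable (InBlock s n i)
inBlock? s n i v = (toℕ i * s ≤? toℕ v) ×-dec (toℕ v <? (toℕ i + 2) * s)

pathEdge : (s n : ℕ) → Fin n → Subset ((n + 1) * s)
pathEdge s n i = ⟦ inBlock? s n i ⟧

private
  ∣interval∣ : ∀ N a w {P : Pred (Fin N) 0ℓ} (P? : Decidable P) →
               (∀ v → P v ⇔ (a ≤ toℕ v × toℕ v < a + w)) →
               a + w ≤ N → ∣ ⟦ P? ⟧ ∣ ≡ w
  ∣interval∣ zero zero zero P? P⇔ _ = refl
  ∣interval∣ (suc N) zero zero P? P⇔ _ with P? zero
  ... | yes p with () ← proj₂ (Equivalence.to (P⇔ zero) p)
  ... | no _ = ∣interval∣ N zero zero (P? ∘ suc)
    (λ v → mk⇔ (λ p → ⊥-elim (n≮0 (proj₂ (Equivalence.to (P⇔ (suc v)) p))))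
               (λ { (_ , ()) }))
    z≤n
  ∣interval∣ (suc N) zero (suc w) P? P⇔ w<N with P? zero
  ... | no ¬p = ⊥-elim (¬p (Equivalence.from (P⇔ zero) (z≤n , s≤s z≤n)))
  ... | yes _ = cong suc (∣interval∣ N zero w (P? ∘ suc)
    (λ v → mk⇔ (λ p → z≤n , s≤s⁻¹ (proj₂ (Equivalence.to (P⇔ (suc v)) p)))
               (λ (_ , v<w) → Equivalence.from (P⇔ (suc v)) (z≤n , s≤s v<w)))
    (s≤s⁻¹ w<N))
  ∣interval∣ (suc N) (suc a) w P? P⇔ a+w<N with P? zero
  ... | yes p with () ← proj₁ (Equivalence.to (P⇔ zero) p)
  ... | no _ = ∣interval∣ N a w (P? ∘ suc)
    (λ v → mk⇔ (λ p → let (l , u) = Equivalence.to (P⇔ (suc v)) p in s≤s⁻¹ l , s≤s⁻¹ u)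
               (λ (l , u) → Equivalence.from (P⇔ (suc v)) (s≤s l , s≤s u)))
    (s≤s⁻¹ a+w<N)

∣pathEdge∣ : ∀ s n i → ∣ pathEdge s n i ∣ ≡ 2 * s
∣pathEdge∣ s n i = ∣interval∣ ((n + 1) * s) (toℕ i * s) (2 * s) (inBlock? s n i)
  (λ v → mk⇔ (map₂ (λ u → subst (toℕ v <_) distrib u))
             (map₂ (λ u → subst (toℕ v <_) (sym distrib) u)))
  (subst (_≤ (n + 1) * s) distrib (*-monoˡ-≤ s i+2≤n+1))
  where
  distrib : (toℕ i + 2) * s ≡ toℕ i * s + 2 * s
  distrib = *-distribʳ-+ s (toℕ i) 2

  i+2≤n+1 : toℕ i + 2 ≤ n + 1
  i+2≤n+1 = ≤-trans (≤-reflexive (+-suc (toℕ i) 1)) (+-monoˡ-≤ 1 (toℕ<n i))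

path : (s n : ℕ) → Hypergraph (2 * s)
path s n = record
  { vertices = (n + 1) * s
  ; Edge     = λ e → ∃[ i ] e ≡ pathEdge s n i
  ; uniform  = λ (i , e≡) → trans (cong ∣_∣ e≡) (∣pathEdge∣ s n i)
  }

{-# OPTIONS --safe #-}

-- Lower bound: on (n + 1) s vertices, colour blue the edges through one fixed
-- vertex. A red copy of the path on n edges would have to cover that vertex,
-- and a blue copy of the path on 4 edges has two disjoint edges.
--
-- Upper bound: call s-sets blocks, so that a family of disjoint blocks carries
-- a coloured complete graph. With (n + 1) s + 1 vertices, n + 1 disjoint blocks
-- always leave a free vertex, and exchanging vertices one at a time through it
-- swaps two blocks a and b. Hence a property of a that survives every change of
-- a or of b alone also holds for b. Two properties survive in this way unless
-- one of the two wanted paths appears: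
--   * a is joined in blue to b and to three further blocks, the last of which
--     starts a red path through the remaining blocks;
--   * among six blocks, a is joined in blue to the blocks of a blue triangle.
-- If both a and b have the property, there is a blue path on 4 edges. By
-- induction on n take a red path on n - 1 edges and a new block a: then one of
-- the properties holds for a. For n = 4, some block among five is joined to the
-- other four in a single colour, and the first property applies, possibly with
-- the colours interchanged. All statements about the coloured complete graphs
-- are finite and are decided by a propositional refutation procedure.
module Submission where

open import Defs
import Algebra.Solver.CommutativeMonoid as CommutativeMonoidSolver
open import Data.Bool using (Bool; true; false; _∧_; if_then_else_)
open import Data.Empty using (⊥-elim)
open import Data.Fin
  using (Fin; zero; suc; toℕ; fromℕ<; cast; combine; quotient; remainder; punchOut)
import Data.Fin.Properties as Fin
open import Data.Fin.Subset using (Subset; ∣_∣) renaming (_∈_ to _∈ˢ_)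
open import Data.Fin.Subset.Properties using () renaming (_∈?_ to _∈ˢ?_)
open import Data.List
  using (List; []; _∷_; [_]; _++_; map; concatMap; filter; take; drop; length; lookup)
open import Data.List.Extrema.Nat using (argmin; argmin-all)
import Data.List.Membership.DecPropositional as DecMembership
open import Data.List.Membership.Propositional using (_∈_; _∉_)
import Data.List.Membership.Propositional.Properties as ∈
import Data.List.Properties as List
open import Data.List.Relation.Binary.Permutation.Propositional
  using (_↭_; refl; prep; swap; ↭-refl; ↭-sym; ↭-trans; ↭-reflexive; ↭⇒↭ₛ)
  renaming (trans to _then_)
import Data.List.Relation.Binary.Permutation.Propositional.Properties as ↭
import Data.List.Relation.Binary.Permutation.Setoid.Properties as ↭ₛ
open import Data.List.Relation.Unary.All as All using (All; []; _∷_; all?)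
import Data.List.Relation.Unary.All.Properties as All
open import Data.List.Relation.Unary.AllPairs as AllPairs using ([]; _∷_)
open import Data.List.Relation.Unary.Any as Any using (Any; here; there; any?)
import Data.List.Relation.Unary.Any.Properties as Any
open import Data.List.Relation.Unary.Linked as Linked using (Linked; []; [-]; _∷_)
open import Data.List.Relation.Unary.Unique.Propositional using (Unique)
open import Data.Nat using (ℕ; zero; suc; _+_; _*_; _≤_; _<_; _≥_; z≤n; s≤s; _<ᵇ_; _≟_)
import Data.Nat.Properties as ℕ
open import Data.Product using (∃; _×_; _,_; proj₁; proj₂; map₁; map₂)
open import Data.Product.Properties using (≡-dec)
open import Data.Sum as Sum using (_⊎_; inj₁; inj₂)
open import Data.Vec as Vec using (Vec; []; _∷_; toList)
import Data.Vec.Membership.Propositional.Properties as Vec∈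
import Data.Vec.Properties as Vec
import Data.Vec.Relation.Unary.Any as VecAny
import Data.Vec.Relation.Unary.Any.Properties as VecAny
open import Function using (_∘_)
open import Function.Bundles using (_⇔_; mk⇔; Equivalence)
open import Function.Definitions using (Injective)
open import Level using (0ℓ)
open import Relation.Binary.Definitions using (DecidableEquality)
open import Relation.Binary.PropositionalEquality
  using (_≡_; _≢_; refl; sym; trans; cong; cong₂; subst; setoid)
open import Relation.Nullary using (¬_; Dec; yes; no; does; ¬?)
open import Relation.Nullary.Decidable using (does-⇔; dec-true; _×-dec_)
open import Relation.Unary using (Pred; Decidable)

-- Clauses about coloured pairs and the refutation procedure

opposite : Colour → Colour
opposite red  = blue
opposite blue = red

_≟ᶜ_ : DecidableEquality Colour
red  ≟ᶜ red  = yes refl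
red  ≟ᶜ blue = no λ ()
blue ≟ᶜ red  = no λ ()
blue ≟ᶜ blue = yes refl

≢⇒opposite : ∀ {c d} → c ≢ d → c ≡ opposite d
≢⇒opposite {red}  {red}  c≢d = ⊥-elim (c≢d refl)
≢⇒opposite {red}  {blue} c≢d = refl
≢⇒opposite {blue} {red}  c≢d = refl
≢⇒opposite {blue} {blue} c≢d = ⊥-elim (c≢d refl)

Pair Literal Clause : Set
Pair    = ℕ × ℕ
Literal = Pair × Colour
Clause  = List Literal

_≟ᵖ_ : DecidableEquality Pair
_≟ᵖ_ = ≡-dec ℕ._≟_ ℕ._≟_

_≟ˡ_ : DecidableEquality Literal
_≟ˡ_ = ≡-dec _≟ᵖ_ _≟ᶜ_

open DecMembership _≟ˡ_ using () renaming (_∈?_ to _∈ˡ?_)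

assign : Literal → List Clause → List Clause
assign l cs = map (filter (λ l′ → ¬? (proj₁ l′ ≟ᵖ proj₁ l)))
                  (filter (λ cl → ¬? (l ∈ˡ? cl)) cs)

-- Splits on a shortest clause, which subsumes unit propagation.
refute : ℕ → List Clause → Bool
refute zero    _         = false
refute (suc k) []        = false
refute (suc k) (cl ∷ cs) with argmin length cl cs
... | []          = true
... | (p , _) ∷ _ = refute k (assign (p , red)  (cl ∷ cs)) ∧
                    refute k (assign (p , blue) (cl ∷ cs))

negate : List Literal → Clause
negate = map (map₂ opposite)

module _ {A : Set} {P : Clause → Set} where

  sequence : ∀ {cs} → All (λ cl → A ⊎ P cl) cs → A ⊎ All P cs
  sequence []             = inj₂ []
  sequence (inj₁ a ∷ _)   = inj₁ a
  sequence (inj₂ p ∷ ps) with sequence ps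
  ... | inj₁ a   = inj₁ a
  ... | inj₂ ps′ = inj₂ (p ∷ ps′)

module Valuation (ρ : ℕ → ℕ → Colour) where

  Holds : Literal → Set
  Holds ((i , j) , c) = ρ i j ≡ c

  holds? : ∀ l → Dec (Holds l)
  holds? ((i , j) , c) = ρ i j ≟ᶜ c

  Sat : Clause → Set
  Sat = Any Holds

  -- A deleted literal has the pair of `l` but, as `l ∉ cl`, the other colour; so it is false and
  -- cannot be the one that satisfies `cl`.
  filter-sat : ∀ {l cl} → Holds l → l ∉ cl → Sat cl →
               Sat (filter (λ l′ → ¬? (proj₁ l′ ≟ᵖ proj₁ l)) cl)
  filter-sat {l} {l′ ∷ cl} h l∉ s with proj₁ l′ ≟ᵖ proj₁ l
  filter-sat h l∉ (here h′) | yes refl = ⊥-elim (l∉ (here (cong (_ ,_) (trans (sym h) h′))))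
  filter-sat h l∉ (there s) | yes _    = filter-sat h (l∉ ∘ there) s
  filter-sat h l∉ (here h′) | no _     = here h′
  filter-sat h l∉ (there s) | no _     = there (filter-sat h (l∉ ∘ there) s)

  assign-sat : ∀ {l} cs → Holds l → All Sat cs → All Sat (assign l cs)
  assign-sat {l} cs h ss =
    All.map⁺ (All.zipWith (λ (l∉ , s) → filter-sat h l∉ s)
      (All.all-filter (λ cl → ¬? (l ∈ˡ? cl)) cs , All.filter⁺ _ ss))

  ∧-elim : ∀ {x y} → x ∧ y ≡ true → x ≡ true × y ≡ true
  ∧-elim {true} {true} refl = refl , refl

  -- A satisfied clause is not empty, and a valuation that satisfies all clauses survives in the
  -- branch of the colour it gives to the split pair. Running out of fuel yields `false`, which
  -- costs no soundness.
  refute-sound : ∀ k cs → refute k cs ≡ true → ¬ All Sat cs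
  refute-sound (suc k) (cl ∷ cs) r (s ∷ ss)
    with argmin length cl cs | argmin-all length {P = Sat} s ss
  ... | []                | ()
  ... | ((i , j) , _) ∷ _ | _ with ρ i j in eq
  ... | red  = refute-sound k _ (proj₁ (∧-elim r)) (assign-sat (cl ∷ cs) eq (s ∷ ss))
  ... | blue = refute-sound k _ (proj₂ (∧-elim {refute k (assign ((i , j) , red) (cl ∷ cs))} r))
                                (assign-sat (cl ∷ cs) eq (s ∷ ss))

  negate-sat : ∀ {ls} → ¬ All Holds ls → Sat (negate ls)
  negate-sat {ls} ¬ls =
    Any.map⁺ (Any.map ≢⇒opposite (All.¬All⇒Any¬ holds? ls ¬ls))

  -- Colours are decidable, so if every goal fails, every negated goal is a true clause and the
  -- refutation applies.
  entails : ∀ {A : Set} k goals cs → refute k (map negate goals ++ cs) ≡ true →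
            All (λ cl → A ⊎ Sat cl) cs → A ⊎ Any (All Holds) goals
  entails k goals cs r cs-sat with sequence cs-sat | any? (all? holds?) goals
  ... | inj₁ a  | _        = inj₁ a
  ... | inj₂ _  | yes g    = inj₂ g
  ... | inj₂ ss | no ¬goals = ⊥-elim (refute-sound k _ r
    (All.++⁺ (All.map⁺ (All.map negate-sat (All.¬Any⇒All¬ goals ¬goals))) ss))

-- Clauses that forbid monochromatic paths

splits : ∀ {A : Set} → List A → List (List A × List A)
splits []       = [ ([] , []) ]
splits (x ∷ xs) = ([] , x ∷ xs) ∷ map (map₁ (x ∷_)) (splits xs)

permutations : ∀ {A : Set} → List A → List (List A)
permutations []       = [ [] ]
permutations (x ∷ xs) =
  concatMap (λ ys → map (λ (ls , rs) → ls ++ x ∷ rs) (splits ys)) (permutations xs)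

-- The colouring is symmetric, but `refute` only sees pairs of labels; a normal form makes both
-- orders one propositional variable.
unordered : ℕ → ℕ → Pair
unordered i j = if i <ᵇ j then (i , j) else (j , i)

-- Lists of at most one label give the empty clause, because they are paths already.
forbid : Colour → List ℕ → Clause
forbid c []           = []
forbid c (_ ∷ [])     = []
forbid c (i ∷ j ∷ is) = (unordered i j , opposite c) ∷ forbid c (j ∷ is)

-- A path on 4 edges has five blocks, and the first five entries of all permutations run through all
-- ordered choices of five labels.
noBlue : List ℕ → List Clause
noBlue is = map (λ js → forbid blue (take 5 js)) (permutations is)

-- A split decides which labels precede `t` and which follow `z`; the clause fails only if both
-- outer pieces are red.
noRed : List ℕ → ℕ → ℕ → List Clause
noRed is t z = concatMap
  (λ js → map (λ (ls , rs) → forbid red (ls ++ [ t ]) ++ forbid red (z ∷ rs)) (splits js))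
  (permutations is)

-- One of the goals holds when all hypotheses do, no labels of a sequence in
-- iss form a blue path on five blocks, and no arrangement of the labels js
-- around a red segment from t to z, kept in this direction, is a red path.
record Refutation (hyps : List Literal) (iss : List (List ℕ)) (js : List ℕ) (t z : ℕ)
                  (goals : List (List Literal)) : Set where
  constructor refuted
  field
    check : refute 25 (map negate goals ++ map [_] hyps ++ concatMap noBlue iss ++ noRed js t z)
            ≡ true

-- The finite refutations

coloured : Colour → ℕ → List ℕ → List Literal
coloured c i = map (λ j → (i , j) , c)

-- Labels: 0 and 1 are a block before and after a change, likewise 2 and 3 for a
-- second block, 4 and 5 are fixed blocks, 6 and 7 the ends of a red segment.
-- Thus the literals below only use increasing pairs, as those of forbid do.
pivotal : ℕ → ℕ → List Literal
pivotal i j = coloured blue i (j ∷ 4 ∷ 5 ∷ 6 ∷ [])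

-- A segment that is a single block has `ends` empty and `z` equal to 6; a longer one contributes
-- its far end, label 7, to the possible blue paths.
PivotRefutation : List ℕ → ℕ → ℕ → ℕ → ℕ → ℕ → Set
PivotRefutation ends z i j k l = Refutation (pivotal i j)
  ((i ∷ j ∷ 4 ∷ 5 ∷ 6 ∷ ends) ∷ (k ∷ l ∷ 4 ∷ 5 ∷ 6 ∷ ends) ∷ [])
  (k ∷ l ∷ 4 ∷ 5 ∷ []) 6 z [ pivotal k l ]

leftShort : PivotRefutation [] 6 0 2 1 2
leftShort = refuted refl

leftLong : PivotRefutation [ 7 ] 7 0 2 1 2
leftLong = refuted refl

rightShort : PivotRefutation [] 6 0 2 0 3
rightShort = refuted refl

rightLong : PivotRefutation [ 7 ] 7 0 2 0 3
rightLong = refuted refl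

-- Labels: 0 and 1 are a block before and after a change, 3, 4, 6 a blue triangle.
completeTo : ℕ → List Literal
completeTo i = coloured blue i (3 ∷ 4 ∷ 6 ∷ [])

-- Label 2 is the block that stays, 5 the last of the six blocks. The red segment is block 6 alone,
-- so red paths through all six blocks are excluded.
cliqueRefutation : Refutation
  (completeTo 0 ++ coloured blue 3 (4 ∷ 6 ∷ []) ++ coloured blue 4 [ 6 ])
  [ 0 ∷ 2 ∷ 3 ∷ 4 ∷ 5 ∷ 6 ∷ [] ] (1 ∷ 2 ∷ 3 ∷ 4 ∷ 5 ∷ []) 6 6 [ completeTo 1 ]
cliqueRefutation = refuted refl

-- Labels: 0 is a new block, 1 to 5 start a red path, and 6 is its last block if
-- it is longer than that.
redPath : List Literal
redPath =
  coloured red 1 [ 2 ] ++ coloured red 2 [ 3 ] ++ coloured red 3 [ 4 ] ++ coloured red 4 [ 5 ]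

-- The second goal covers a genuine exception: if 2 and 4 are joined in red to a blue clique on 0,
-- 1, 3, 5, there is no blue path on five blocks, and a red path through all six could contain only
-- three blocks of the clique.
extendShort : Refutation redPath [ 0 ∷ 1 ∷ 2 ∷ 3 ∷ 4 ∷ 5 ∷ [] ] (0 ∷ 1 ∷ 2 ∷ 3 ∷ 4 ∷ []) 5 5
  (coloured blue 0 (1 ∷ 2 ∷ 3 ∷ 4 ∷ []) ∷
   (coloured blue 0 (1 ∷ 3 ∷ 5 ∷ []) ++ coloured blue 1 (3 ∷ 5 ∷ []) ++ coloured blue 3 [ 5 ]) ∷ [])
extendShort = refuted refl

-- A longer red path rules the clique out. Two sets of labels are enough for this and give 720 + 120
-- permutations instead of 7! = 5040.
extendLong : Refutation redPath ((0 ∷ 1 ∷ 2 ∷ 3 ∷ 4 ∷ 6 ∷ []) ∷ (0 ∷ 1 ∷ 3 ∷ 5 ∷ 6 ∷ []) ∷ [])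
  (0 ∷ 1 ∷ 2 ∷ 3 ∷ 4 ∷ []) 5 6 [ coloured blue 0 (1 ∷ 2 ∷ 3 ∷ 4 ∷ []) ]
extendLong = refuted refl

stars : Colour → List (List Literal)
stars c = map (λ (i , is) → map (λ j → unordered i j , c) is)
  ((0 , 1 ∷ 2 ∷ 3 ∷ 4 ∷ []) ∷ (1 , 0 ∷ 2 ∷ 3 ∷ 4 ∷ []) ∷ (2 , 0 ∷ 1 ∷ 3 ∷ 4 ∷ []) ∷
   (3 , 0 ∷ 1 ∷ 2 ∷ 4 ∷ []) ∷ (4 , 0 ∷ 1 ∷ 2 ∷ 3 ∷ []) ∷ [])

-- With block 4 alone as the segment, the arrangements around it are all red paths through the five
-- blocks.
starRefutation : Refutation [] [ 0 ∷ 1 ∷ 2 ∷ 3 ∷ 4 ∷ [] ] (0 ∷ 1 ∷ 2 ∷ 3 ∷ []) 4 4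
  (stars red ++ stars blue)
starRefutation = refuted refl

-- Permutations, lists without repetition, and the exchange of two vectors

splits-++ : ∀ {A : Set} (xs : List A) → All (λ (ls , rs) → ls ++ rs ≡ xs) (splits xs)
splits-++ []       = refl ∷ []
splits-++ (x ∷ xs) = refl ∷ All.map⁺ (All.map (cong (x ∷_)) (splits-++ xs))

permutations-↭ : ∀ {A : Set} (xs : List A) → All (_↭ xs) (permutations xs)
permutations-↭ []       = refl ∷ []
permutations-↭ (x ∷ xs) = All.concat⁺ (All.map⁺ (All.map
  (λ {ys} ys↭xs → All.map⁺ (All.map
    (λ {(ls , rs)} ls++rs≡ys → ↭-trans (↭.shift x ls rs)
      (prep x (↭-trans (↭-reflexive ls++rs≡ys) ys↭xs)))
    (splits-++ ys)))
  (permutations-↭ xs)))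

module _ {A : Set} where

  open CommutativeMonoidSolver (↭.++-commutativeMonoid {A = A}) public
    using (solve; _⊜_; _⊕_)

module _ {A : Set} where

  Unique-↭ : ∀ {xs ys : List A} → xs ↭ ys → Unique xs → Unique ys
  Unique-↭ = ↭ₛ.Unique-resp-↭ (setoid A) ∘ ↭⇒↭ₛ

  Unique-++ˡ : ∀ (xs : List A) {ys} → Unique (xs ++ ys) → Unique xs
  Unique-++ˡ []       _        = []
  Unique-++ˡ (x ∷ xs) (x∉ ∷ u) = All.++⁻ˡ xs x∉ ∷ Unique-++ˡ xs u

  Unique-++ʳ : ∀ (xs : List A) {ys} → Unique (xs ++ ys) → Unique ys
  Unique-++ʳ []       u       = u
  Unique-++ʳ (_ ∷ xs) (_ ∷ u) = Unique-++ʳ xs u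

  Unique-++-disjoint : ∀ {xs ys : List A} → Unique (xs ++ ys) → ∀ {v} → v ∈ xs → v ∉ ys
  Unique-++-disjoint {x ∷ xs} (x∉ ∷ _) (here refl) v∈ys = All.All¬⇒¬Any x∉ (∈.∈-++⁺ʳ xs v∈ys)
  Unique-++-disjoint (_ ∷ u) (there v∈xs)          v∈ys = Unique-++-disjoint u v∈xs v∈ys

  ∈-lookup : ∀ {n} (a : Vec A n) r → Vec.lookup a r ∈ toList a
  ∈-lookup a r = Vec∈.∈-toList⁺ (Vec∈.∈-lookup r a)

  toList-lookup : ∀ {n} {a : Vec A n} {v} → v ∈ toList a → ∃ λ r → Vec.lookup a r ≡ v
  toList-lookup {a = a} v∈ = VecAny.index v∈a , sym (VecAny.lookup-index v∈a)
    where v∈a = Vec∈.∈-toList⁻ {xs = a} v∈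

  Vec-lookup-injective : ∀ {n} {a : Vec A n} → Unique (toList a) →
                         Injective _≡_ _≡_ (Vec.lookup a)
  Vec-lookup-injective {a = x ∷ a} (x∉ ∷ u) {zero}  {zero}  eq = refl
  Vec-lookup-injective {a = x ∷ a} (x∉ ∷ u) {suc r} {suc t} eq = cong suc (Vec-lookup-injective u eq)
  Vec-lookup-injective {a = x ∷ a} (x∉ ∷ u) {zero}  {suc t} eq =
    ⊥-elim (All.All¬⇒¬Any x∉ (subst (_∈ toList a) (sym eq) (∈-lookup a t)))
  Vec-lookup-injective {a = x ∷ a} (x∉ ∷ u) {suc r} {zero}  eq =
    ⊥-elim (All.All¬⇒¬Any x∉ (subst (_∈ toList a) eq (∈-lookup a r)))

-- Coordinate by coordinate, x is parked at the free vertex w, y is moved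
-- to its place, and x is moved to the former place of y.
exchange : ∀ {V : Set} {n} (P : Vec V n → Vec V n → Set) (U : List V) →
  (∀ a a′ b → Unique (toList a ++ toList b ++ U) → Unique (toList a′ ++ toList b ++ U) →
   P a b → P a′ b) →
  (∀ a b b′ → Unique (toList a ++ toList b ++ U) → Unique (toList a ++ toList b′ ++ U) →
   P a b → P a b′) →
  ∀ {w a b} → Unique (w ∷ toList a ++ toList b ++ U) → P a b → P b a
exchange P U left right {w} {[]}     {[]}     u p = p
exchange P U left right {w} {x ∷ a} {y ∷ b} u p =
  exchange (λ c d → P (y ∷ c) (x ∷ d)) (x ∷ y ∷ U)
    (λ c c′ d v v′ → left _ _ _ (regroup c d v) (regroup c′ d v′))
    (λ c d d′ v v′ → right _ _ _ (regroup c d v) (regroup c d′ v′))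
    (Unique-↭ (solve 6 (λ w x y a b u → w ⊕ x ⊕ a ⊕ y ⊕ b ⊕ u ⊜ w ⊕ a ⊕ b ⊕ x ⊕ y ⊕ u)
      ↭-refl [ w ] [ x ] [ y ] (toList a) (toList b) U) u)
    (left (w ∷ a) (y ∷ a) (x ∷ b) wx yx
      (right (w ∷ a) (y ∷ b) (x ∷ b) wy wx
        (left (x ∷ a) (w ∷ a) (y ∷ b) xy wy p)))
  where
  regroup : ∀ c d → Unique (toList c ++ toList d ++ x ∷ y ∷ U) →
            Unique (y ∷ toList c ++ x ∷ toList d ++ U)
  regroup c d = Unique-↭ (solve 5 (λ x y c d u → c ⊕ d ⊕ x ⊕ y ⊕ u ⊜ y ⊕ c ⊕ x ⊕ d ⊕ u)
    ↭-refl [ x ] [ y ] (toList c) (toList d) U)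

  xy : Unique (x ∷ toList a ++ y ∷ toList b ++ U)
  xy = AllPairs.tail u

  wy : Unique (w ∷ toList a ++ y ∷ toList b ++ U)
  wy = AllPairs.tail (Unique-↭ (swap w x refl) u)

  without-first : ∀ {v v₁ v₂} → Unique (v ∷ v₁ ∷ toList a ++ v₂ ∷ toList b ++ U) →
                  Unique (v₂ ∷ v₁ ∷ toList a ++ v ∷ toList b ++ U)
  without-first {v} {v₁} {v₂} = Unique-↭ (solve 6
    (λ v v₁ v₂ a b u → v ⊕ v₁ ⊕ a ⊕ v₂ ⊕ b ⊕ u ⊜ v₂ ⊕ v₁ ⊕ a ⊕ v ⊕ b ⊕ u)
    ↭-refl [ v ] [ v₁ ] [ v₂ ] (toList a) (toList b) U)

  wx : Unique (w ∷ toList a ++ x ∷ toList b ++ U)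
  wx = AllPairs.tail (without-first (Unique-↭ (swap w x refl) u))

  yx : Unique (y ∷ toList a ++ x ∷ toList b ++ U)
  yx = AllPairs.tail (Unique-↭ (swap y w refl) (without-first (Unique-↭ (swap w x refl) u)))

-- A valuation colours all pairs of natural numbers, so labels beyond the list need a default.
at : ∀ {A : Set} → A → List A → ℕ → A
at d []       _       = d
at d (x ∷ _)  zero    = x
at d (_ ∷ xs) (suc i) = at d xs i

5≤5+ : ∀ {n} → 5 ≤ 5 + n
5≤5+ = s≤s (s≤s (s≤s (s≤s (s≤s z≤n))))

-- Families of disjoint blocks

module Blocks {V : Set} {s : ℕ} where

  -- The order of the vertices allows exchanges and embeddings to proceed by coordinates; the edge
  -- spanned by two blocks will forget it.
  Block : Set
  Block = Vec V s

  vertexList : List Block → List V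
  vertexList = concatMap toList

  Separated : List Block → Set
  Separated = Unique ∘ vertexList

  vertexList-↭ : ∀ {L M} → L ↭ M → vertexList L ↭ vertexList M
  vertexList-↭ refl          = refl
  vertexList-↭ (prep a p)    = ↭.++⁺ˡ (toList a) (vertexList-↭ p)
  vertexList-↭ (swap a b p)  = ↭-trans (↭.shifts (toList a) (toList b))
    (↭.++⁺ˡ (toList b) (↭.++⁺ˡ (toList a) (vertexList-↭ p)))
  vertexList-↭ (p then q)    = ↭-trans (vertexList-↭ p) (vertexList-↭ q)

  Separated-↭ : ∀ {L M} → L ↭ M → Separated L → Separated M
  Separated-↭ = Unique-↭ ∘ vertexList-↭

  Separated-++ˡ : ∀ L {M} → Separated (L ++ M) → Separated L
  Separated-++ˡ L {M} u = Unique-++ˡ (vertexList L)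
    (subst Unique (List.concatMap-++ toList L M) u)

  record HasHole (L : List Block) : Set where
    constructor _∉∷_
    field
      vertex   : V
      distinct : Unique (vertex ∷ vertexList L)

  HasHole-↭ : ∀ {L M} → L ↭ M → HasHole L → HasHole M
  HasHole-↭ p (w ∉∷ u) = w ∉∷ Unique-↭ (prep w (vertexList-↭ p)) u

  length-vertexList : ∀ L → length (vertexList L) ≡ length L * s
  length-vertexList []      = refl
  length-vertexList (a ∷ L) = trans (List.length-++ (toList a))
    (cong₂ _+_ (Vec.length-toList a) (length-vertexList L))

  ∈-vertexList : ∀ L i r → Vec.lookup (lookup L i) r ∈ vertexList L
  ∈-vertexList (a ∷ L) zero    r = ∈.∈-++⁺ˡ (∈-lookup a r)
  ∈-vertexList (a ∷ L) (suc i) r = ∈.∈-++⁺ʳ (toList a) (∈-vertexList L i r)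

  lookup-separated : ∀ L → Separated L → ∀ i j {r t} →
    Vec.lookup (lookup L i) r ≡ Vec.lookup (lookup L j) t → i ≡ j × r ≡ t
  lookup-separated (a ∷ L) u zero zero eq = refl , Vec-lookup-injective (Unique-++ˡ (toList a) u) eq
  lookup-separated (a ∷ L) u zero (suc j) {r} {t} eq = ⊥-elim (Unique-++-disjoint u
    (∈-lookup a r) (subst (_∈ vertexList L) (sym eq) (∈-vertexList L j t)))
  lookup-separated (a ∷ L) u (suc i) zero {r} {t} eq = ⊥-elim (Unique-++-disjoint u
    (∈-lookup a t) (subst (_∈ vertexList L) eq (∈-vertexList L i r)))
  lookup-separated (a ∷ L) u (suc i) (suc j) eq =
    let i≡j , r≡t = lookup-separated L (Unique-++ʳ (toList a) u) i j eq in cong suc i≡j , r≡t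

  lookup-linked : ∀ {R : Block → Block → Set} L → Separated L → Linked R L →
    ∀ i j → toℕ j ≡ suc (toℕ i) →
    Unique (toList (lookup L i) ++ toList (lookup L j)) × R (lookup L i) (lookup L j)
  lookup-linked (a ∷ b ∷ L) u (e ∷ l) zero (suc zero) _ =
    Unique-++ˡ (toList a ++ toList b)
      (subst Unique (sym (List.++-assoc (toList a) (toList b) (vertexList L))) u) , e
  lookup-linked (a ∷ L) u l (suc i) (suc j) j≡ =
    lookup-linked L (Unique-++ʳ (toList a) u) (Linked.tail l) i j (ℕ.suc-injective j≡)

  -- Paths of blocks and soundness of the clauses

  Joined : (Block → Block → Colour) → Colour → Block → Block → Set
  Joined col c a b = col a b ≡ c

  Path : (Block → Block → Colour) → Colour → List Block → Set
  Path col c = Linked (Joined col c)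

  -- A stands for the existence of one of the two paths: as it is not known to be
  -- decidable, it is carried along instead of being refuted.
  module Search (col : Block → Block → Colour) (col-sym : ∀ a b → col a b ≡ col b a)
    {A : Set} {m : ℕ}
    (foundRed  : ∀ {L} → length L ≡ m → Separated L → Path col red L → A)
    (foundBlue : ∀ {L} → length L ≡ 5 → Separated L → Path col blue L → A)
    where

    -- With both ends as indices, a red path of any length enters a finite refutation through two
    -- labels.
    data Segment : Block → List Block → Block → Set where
      single : ∀ {a} → Segment a [ a ] a
      _∷_    : ∀ {a b T z} → Joined col red a b → Segment b T z → Segment a (a ∷ T) z

    segment : ∀ {t T} → Path col red (t ∷ T) → ∃ (Segment t (t ∷ T))
    segment [-]     = _ , single
    segment (e ∷ l) = let (z , S) = segment l in z , e ∷ S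

    splice : ∀ L {M t T z} → Segment t T z → Path col red (L ++ [ t ]) →
             Path col red (z ∷ M) → Path col red (L ++ T ++ M)
    splice [] single _ l           = l
    splice [] (e ∷ single) _ l     = e ∷ l
    splice [] (e ∷ S@(_ ∷ _)) _ l  = e ∷ splice [] S [-] l
    splice (a ∷ []) single (e ∷ _) l = e ∷ l
    splice (a ∷ []) S@(_ ∷ _) (e ∷ _) l = e ∷ splice [] S [-] l
    splice (a ∷ L@(_ ∷ _)) S (e ∷ k) l = e ∷ splice L S k l

    segment-head : ∀ {t T z} → Segment t T z → ∃ λ T′ → T ≡ t ∷ T′
    segment-head single  = _ , refl
    segment-head (_ ∷ _) = _ , refl

    -- This distinguishes the short from the long refutations, according to whether the ends need
    -- one label or two.
    segment-ends : ∀ {t T z} → Segment t T z → (T ≡ [ t ] × z ≡ t) ⊎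
                   ∃ λ mid → T ↭ t ∷ z ∷ mid
    segment-ends single = inj₁ (refl , refl)
    segment-ends {t} (e ∷ S) with segment-ends S
    ... | inj₁ (refl , refl) = inj₂ ([] , refl)
    ... | inj₂ (mid , p) = inj₂ (_ , prep t (↭-trans p (swap _ _ refl)))

    module Labelled (h : ℕ → Block) where

      open Valuation (λ i j → col (h i) (h j)) public

      forbid-sound : ∀ c is → Path col c (map h is) ⊎ Sat (forbid c is)
      forbid-sound c []       = inj₁ []
      forbid-sound c (_ ∷ []) = inj₁ [-]
      forbid-sound c (i ∷ j ∷ is) with col (h i) (h j) ≟ᶜ c | forbid-sound c (j ∷ is)
      ... | yes e | inj₁ l = inj₁ (e ∷ l)
      ... | yes _ | inj₂ s = inj₂ (there s)
      -- `unordered` may have swapped the pair, which `col-sym` undoes.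
      ... | no ¬e | _ with i <ᵇ j
      ...   | true  = inj₂ (here (≢⇒opposite ¬e))
      ...   | false = inj₂ (here (trans (col-sym (h j) (h i)) (≢⇒opposite ¬e)))

      -- A violated clause is a blue path for `foundBlue`. `M` takes up the blocks outside `is`, so
      -- that separation of a larger family can be supplied.
      noBlue-sound : ∀ is {M} → 5 ≤ length is → Separated (map h is ++ M) →
                     All (λ cl → A ⊎ Sat cl) (noBlue is)
      noBlue-sound is {M} 5≤ u = All.map⁺ (All.map clause (permutations-↭ is))
        where
        clause : ∀ {js} → js ↭ is → A ⊎ Sat (forbid blue (take 5 js))
        clause {js} js↭is with forbid-sound blue (take 5 js)
        ... | inj₂ s = inj₂ s
        ... | inj₁ l = inj₁ (foundBlue
          (trans (List.length-map h (take 5 js)) (trans (List.length-take 5 js)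
            (ℕ.m≤n⇒m⊓n≡m (ℕ.≤-trans 5≤ (ℕ.≤-reflexive (sym (↭.↭-length js↭is)))))))
          (Separated-++ˡ (map h (take 5 js)) (Separated-↭ (↭-trans
            (↭.++⁺ʳ M (↭.map⁺ h (↭-sym js↭is)))
            (↭-reflexive (trans
              (cong (_++ M) (trans (cong (map h) (sym (List.take++drop≡id 5 js)))
                                   (List.map-++ h (take 5 js) (drop 5 js))))
              (List.++-assoc (map h (take 5 js)) _ M)))) u))
          l)

      -- If both outer pieces are red, splicing them to the segment gives a red path through all `m`
      -- blocks.
      noRed-sound : ∀ is {t z T} → Segment (h t) T (h z) → length (map h is ++ T) ≡ m →
                    Separated (map h is ++ T) → All (λ cl → A ⊎ Sat cl) (noRed is t z)
      noRed-sound is {t} {z} {T} S len u = All.concat⁺ (All.map⁺ (All.map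
          (λ {js} js↭is → All.map⁺ (All.map (λ {ls,rs} → clause js↭is ls,rs) (splits-++ js)))
          (permutations-↭ is)))
        where
        clause : ∀ {js} → js ↭ is → ∀ ((ls , rs) : List ℕ × List ℕ) → ls ++ rs ≡ js →
                 A ⊎ Sat (forbid red (ls ++ [ t ]) ++ forbid red (z ∷ rs))
        clause js↭is (ls , rs) refl with forbid-sound red (ls ++ [ t ]) | forbid-sound red (z ∷ rs)
        ... | inj₂ s | _      = inj₂ (Any.++⁺ˡ s)
        ... | inj₁ _ | inj₂ s = inj₂ (Any.++⁺ʳ (forbid red (ls ++ [ t ])) s)
        ... | inj₁ k | inj₁ l = inj₁ (foundRed
            (trans (sym (↭.↭-length L↭)) len)
            (Separated-↭ L↭ u)
            (splice (map h ls) S (subst (Linked _) (List.map-++ h ls [ t ]) k) l))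
          where
          L↭ : map h is ++ T ↭ map h ls ++ T ++ map h rs
          L↭ = ↭-trans (↭.++⁺ʳ T (↭-trans (↭.map⁺ h (↭-sym js↭is))
                                          (↭-reflexive (List.map-++ h ls rs))))
            (solve 3 (λ l r t → (l ⊕ r) ⊕ t ⊜ l ⊕ t ⊕ r) ↭-refl (map h ls) (map h rs) T)

      derive : ∀ hyps iss js t z goals →
        Refutation hyps iss js t z goals →
        All Holds hyps →
        All (λ is → 5 ≤ length is × ∃ λ M → Separated (map h is ++ M)) iss →
        ∀ {T} → Segment (h t) T (h z) → length (map h js ++ T) ≡ m → Separated (map h js ++ T) →
        A ⊎ Any (All Holds) goals
      -- Each split eliminates one pair. Every refutation above involves at most seven labels, hence
      -- at most 21 pairs, so fuel 25 suffices.
      derive hyps iss js t z goals (refuted r) hs us S len u = entails 25 goals _ r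
        (All.++⁺ {xs = map [_] hyps} (All.map⁺ (All.map (inj₂ ∘ here) hs))
          (All.++⁺ {xs = concatMap noBlue iss}
            (All.concat⁺ (All.map⁺ (All.map (λ {is} (5≤ , _ , u) → noBlue-sound is 5≤ u) us)))
            (noRed-sound js S len u)))

    -- The two properties that survive exchanges, and the extension of a red path

    module Pivot (x y t : Block) {T : List Block} {z : Block} (S : Segment t T z)
                 (len : 4 + length T ≡ m) where

      -- The alternative `A` carries along a wanted path that turns up in the middle of an exchange.
      Pivotal : Block → Block → Set
      Pivotal a b = A ⊎ All (Joined col blue a) (b ∷ x ∷ y ∷ t ∷ [])

      module Change (a a′ b b′ : Block) where
        h : ℕ → Block
        h = at a (a ∷ a′ ∷ b ∷ b′ ∷ x ∷ y ∷ t ∷ z ∷ [])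
        open Labelled h

        -- Changes of either block and segments of either kind become one statement on labels: `i`,
        -- `j` before the change, `k`, `l` after it, and `mid` for the interior of the segment.
        change : ∀ ends ζ mid i j k l →
          PivotRefutation ends ζ i j k l →
          T ↭ t ∷ map h ends ++ mid → Segment t T (h ζ) →
          Separated (h i ∷ h j ∷ x ∷ y ∷ T) → Separated (h k ∷ h l ∷ x ∷ y ∷ T) →
          All (Joined col blue (h i)) (h j ∷ x ∷ y ∷ t ∷ []) → Pivotal (h k) (h l)
        change ends ζ mid i j k l r T↭ S′ u u′ (e₁ ∷ e₂ ∷ e₃ ∷ e₄ ∷ []) = Sum.map₂ conclude
          (derive (pivotal i j) _ (k ∷ l ∷ 4 ∷ 5 ∷ []) 6 ζ [ pivotal k l ] r
            (e₁ ∷ e₂ ∷ e₃ ∷ e₄ ∷ [])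
            ((5≤5+ , mid , Separated-↭ (↭.++⁺ˡ (h i ∷ h j ∷ x ∷ y ∷ []) T↭) u) ∷
             (5≤5+ , mid , Separated-↭ (↭.++⁺ˡ (h k ∷ h l ∷ x ∷ y ∷ []) T↭) u′) ∷ []) S′ len u′)
          where
          conclude : Any (All Holds) [ pivotal k l ] →
                     All (Joined col blue (h k)) (h l ∷ x ∷ y ∷ t ∷ [])
          conclude (here (e₁ ∷ e₂ ∷ e₃ ∷ e₄ ∷ [])) = e₁ ∷ e₂ ∷ e₃ ∷ e₄ ∷ []

      left : ∀ a a′ b → Separated (a ∷ b ∷ x ∷ y ∷ T) → Separated (a′ ∷ b ∷ x ∷ y ∷ T) →
             Pivotal a b → Pivotal a′ b
      left a a′ b u u′ (inj₁ found) = inj₁ found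
      left a a′ b u u′ (inj₂ es) with segment-ends S
      ... | inj₁ (refl , refl) = change [] 6 [] 0 2 1 2 leftShort ↭-refl S u u′ es
        where open Change a a′ b b
      ... | inj₂ (mid , T↭) = change [ 7 ] 7 mid 0 2 1 2 leftLong T↭ S u u′ es
        where open Change a a′ b b

      right : ∀ a b b′ → Separated (a ∷ b ∷ x ∷ y ∷ T) → Separated (a ∷ b′ ∷ x ∷ y ∷ T) →
              Pivotal a b → Pivotal a b′
      right a b b′ u u′ (inj₁ found) = inj₁ found
      right a b b′ u u′ (inj₂ es) with segment-ends S
      ... | inj₁ (refl , refl) = change [] 6 [] 0 2 0 3 rightShort ↭-refl S u u′ es
        where open Change a a b b′
      ... | inj₂ (mid , T↭) = change [ 7 ] 7 mid 0 2 0 3 rightLong T↭ S u u′ es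
        where open Change a a b b′

      -- After the exchange `b` too is joined in blue to `x` and `y`, so `x`, `b`, `y`, `a`, `t` is
      -- a blue path.
      pivotal⇒found : ∀ {a b} → HasHole (a ∷ b ∷ x ∷ y ∷ T) →
                       All (Joined col blue a) (b ∷ x ∷ y ∷ t ∷ []) → A
      pivotal⇒found {a} {b} (w ∉∷ u) es@(_ ∷ ax ∷ ay ∷ at ∷ [])
        with exchange Pivotal (vertexList (x ∷ y ∷ T)) left right u (inj₂ es) | segment-head S
      ... | inj₁ found | _ = found
      ... | inj₂ (_ ∷ bx ∷ by ∷ _ ∷ []) | T′ , refl =
        foundBlue {x ∷ b ∷ y ∷ a ∷ t ∷ []} refl
          (Separated-++ˡ (x ∷ b ∷ y ∷ a ∷ t ∷ []) {T′} (Separated-↭ (solve 5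
            (λ a b x y t → a ⊕ b ⊕ x ⊕ y ⊕ t ⊜ x ⊕ b ⊕ y ⊕ a ⊕ t)
            ↭-refl [ a ] [ b ] [ x ] [ y ] T) (AllPairs.tail u)))
          (trans (col-sym x b) bx ∷ by ∷ trans (col-sym y a) ay ∷ at ∷ [-])

    module Clique (x y v z : Block) (m≡6 : m ≡ 6)
      (xy : Joined col blue x y) (xz : Joined col blue x z) (yz : Joined col blue y z) where

      Complete : Block → Set
      Complete a = A ⊎ All (Joined col blue a) (x ∷ y ∷ z ∷ [])

      module Change (a a′ b : Block) where
        open Labelled (at a (a ∷ a′ ∷ b ∷ x ∷ y ∷ v ∷ z ∷ []))

        change : Separated (a ∷ b ∷ x ∷ y ∷ v ∷ z ∷ []) →
                 Separated (a′ ∷ b ∷ x ∷ y ∷ v ∷ z ∷ []) →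
                 Complete a → Complete a′
        change u u′ (inj₁ found) = inj₁ found
        change u u′ (inj₂ (ax ∷ ay ∷ az ∷ [])) = Sum.map₂ conclude (derive
          (completeTo 0 ++ coloured blue 3 (4 ∷ 6 ∷ []) ++ coloured blue 4 [ 6 ])
          [ 0 ∷ 2 ∷ 3 ∷ 4 ∷ 5 ∷ 6 ∷ [] ] (1 ∷ 2 ∷ 3 ∷ 4 ∷ 5 ∷ []) 6 6 [ completeTo 1 ]
          cliqueRefutation
          (ax ∷ ay ∷ az ∷ xy ∷ xz ∷ yz ∷ []) ((5≤5+ , [] , u) ∷ []) single (sym m≡6) u′)
          where
          conclude : Any (All Holds) [ completeTo 1 ] → All (Joined col blue a′) (x ∷ y ∷ z ∷ [])
          conclude (here (e₁ ∷ e₂ ∷ e₃ ∷ [])) = e₁ ∷ e₂ ∷ e₃ ∷ []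

      -- `Complete` concerns one block only, so changes of the other preserve it trivially. After
      -- the exchange `b`, `x`, `a`, `y`, `z` is a blue path.
      clique⇒found : ∀ {a b} → HasHole (a ∷ b ∷ x ∷ y ∷ v ∷ z ∷ []) →
                      All (Joined col blue a) (x ∷ y ∷ z ∷ []) → A
      clique⇒found {a} {b} (w ∉∷ u) es@(ax ∷ ay ∷ _ ∷ [])
        with exchange (λ c _ → Complete c) (vertexList (x ∷ y ∷ v ∷ z ∷ []))
               (λ c c′ d → Change.change c c′ d) (λ _ _ _ _ _ p → p) {w} {a} {b} u (inj₂ es)
      ... | inj₁ found = found
      ... | inj₂ (bx ∷ _ ∷ _ ∷ []) =
        foundBlue {b ∷ x ∷ a ∷ y ∷ z ∷ []} refl
          (Separated-++ˡ (b ∷ x ∷ a ∷ y ∷ z ∷ []) {v ∷ []} (Separated-↭ (solve 6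
            (λ a b x y v z → a ⊕ b ⊕ x ⊕ y ⊕ v ⊕ z ⊜ b ⊕ x ⊕ a ⊕ y ⊕ z ⊕ v)
            ↭-refl [ a ] [ b ] [ x ] [ y ] [ v ] [ z ]) (AllPairs.tail u)))
          (bx ∷ trans (col-sym x a) ax ∷ ay ∷ yz ∷ [-])

    -- A blue star from `x₀` to `x₁`, ..., `x₄` makes `x₀` pivotal with partner `x₁`, the red
    -- segment being the rest of the path from `x₄` on.
    extend⇒found : ∀ {x₀ x₁ x₂ x₃ x₄ x₅ R} → 6 + length R ≡ m →
             HasHole (x₀ ∷ x₁ ∷ x₂ ∷ x₃ ∷ x₄ ∷ x₅ ∷ R) →
             Path col red (x₁ ∷ x₂ ∷ x₃ ∷ x₄ ∷ x₅ ∷ R) → A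
    extend⇒found {x₀} {x₁} {x₂} {x₃} {x₄} {x₅} {R} len hole@(w ∉∷ u) (r₁ ∷ r₂ ∷ r₃ ∷ r₄ ∷ l)
      with z , S ← segment l | segment-ends S
    ... | inj₁ (refl , refl) = conclude (derive redPath _ _ 5 5 _ extendShort
          (r₁ ∷ r₂ ∷ r₃ ∷ r₄ ∷ []) ((5≤5+ , [] , AllPairs.tail u) ∷ []) S len (AllPairs.tail u))
      where
      open Labelled (at x₀ (x₀ ∷ x₁ ∷ x₂ ∷ x₃ ∷ x₄ ∷ x₅ ∷ []))
      conclude : A ⊎ Any (All Holds) _ → A
      conclude (inj₁ found) = found
      conclude (inj₂ (here (e₁ ∷ e₂ ∷ e₃ ∷ e₄ ∷ []))) =
        Pivot.pivotal⇒found x₂ x₃ x₄ (r₄ ∷ S) len hole (e₁ ∷ e₂ ∷ e₃ ∷ e₄ ∷ [])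
      -- The triangle is `x₁`, `x₃`, `x₅`; the partner exchanged with `x₀` is `x₂`, hence the swap.
      conclude (inj₂ (there (here (e₀₁ ∷ e₀₃ ∷ e₀₅ ∷ e₁₃ ∷ e₁₅ ∷ e₃₅ ∷ [])))) =
        Clique.clique⇒found x₁ x₃ x₄ x₅ (sym len) e₁₃ e₁₅ e₃₅
          (HasHole-↭ (prep x₀ (swap x₁ x₂ refl)) hole) (e₀₁ ∷ e₀₃ ∷ e₀₅ ∷ [])
    ... | inj₂ (mid , R↭) = conclude (derive redPath _ _ 5 6 _ extendLong
          (r₁ ∷ r₂ ∷ r₃ ∷ r₄ ∷ [])
          ((5≤5+ , x₅ ∷ mid , Separated-↭ (↭-trans (↭.++⁺ˡ (x₀ ∷ x₁ ∷ x₂ ∷ x₃ ∷ x₄ ∷ []) R↭)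
              (↭.++⁺ˡ (x₀ ∷ x₁ ∷ x₂ ∷ x₃ ∷ x₄ ∷ []) (swap x₅ z refl))) (AllPairs.tail u)) ∷
           (5≤5+ , x₂ ∷ x₄ ∷ mid , Separated-↭ (↭-trans (↭.++⁺ˡ (x₀ ∷ x₁ ∷ x₂ ∷ x₃ ∷ x₄ ∷ []) R↭)
              (solve 8 (λ a b c d e f g h →
                  a ⊕ b ⊕ c ⊕ d ⊕ e ⊕ f ⊕ g ⊕ h ⊜ a ⊕ b ⊕ d ⊕ f ⊕ g ⊕ c ⊕ e ⊕ h)
                ↭-refl [ x₀ ] [ x₁ ] [ x₂ ] [ x₃ ] [ x₄ ] [ x₅ ] [ z ] mid)) (AllPairs.tail u)) ∷ [])
          S len (AllPairs.tail u))
      where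
      open Labelled (at x₀ (x₀ ∷ x₁ ∷ x₂ ∷ x₃ ∷ x₄ ∷ x₅ ∷ z ∷ []))
      conclude : A ⊎ Any (All Holds) _ → A
      conclude (inj₁ found) = found
      conclude (inj₂ (here (e₁ ∷ e₂ ∷ e₃ ∷ e₄ ∷ []))) =
        Pivot.pivotal⇒found x₂ x₃ x₄ (r₄ ∷ S) len hole (e₁ ∷ e₂ ∷ e₃ ∷ e₄ ∷ [])

  -- Five blocks, the base of the induction

  module FiveBlocks (col : Block → Block → Colour) (col-sym : ∀ a b → col a b ≡ col b a)
    {A : Set}
    (foundRed  : ∀ {L} → length L ≡ 5 → Separated L → Path col red L → A)
    (foundBlue : ∀ {L} → length L ≡ 5 → Separated L → Path col blue L → A)
    where

    open Search col col-sym {A} {5} foundRed foundBlue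

    opposite-injective : ∀ {c d} → opposite c ≡ opposite d → c ≡ d
    opposite-injective {red}  {red}  _ = refl
    opposite-injective {blue} {blue} _ = refl

    -- Here both wanted paths have five blocks, so interchanging the colours gives another instance
    -- of `Search`, which handles red stars.
    col′ : Block → Block → Colour
    col′ a b = opposite (col a b)

    col′-sym : ∀ a b → col′ a b ≡ col′ b a
    col′-sym a b = cong opposite (col-sym a b)

    foundRed′ : ∀ {L} → length L ≡ 5 → Separated L → Path col′ red L → A
    foundRed′ len u l = foundBlue len u (Linked.map opposite-injective l)

    foundBlue′ : ∀ {L} → length L ≡ 5 → Separated L → Path col′ blue L → A
    foundBlue′ len u l = foundRed len u (Linked.map opposite-injective l)

    module Opposite = Search col′ col′-sym {A} {5} foundRed′ foundBlue′

    star⇒found : ∀ c {a b x y t} → HasHole (a ∷ b ∷ x ∷ y ∷ t ∷ []) →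
                  All (Joined col c a) (b ∷ x ∷ y ∷ t ∷ []) → A
    star⇒found blue {x = x} {y} {t} hole es = Pivot.pivotal⇒found x y t single refl hole es
    star⇒found red  {x = x} {y} {t} hole es =
      Opposite.Pivot.pivotal⇒found x y t Opposite.single refl hole (All.map (cong opposite) es)

    five-blocks⇒found : ∀ {x₀ x₁ x₂ x₃ x₄} → HasHole (x₀ ∷ x₁ ∷ x₂ ∷ x₃ ∷ x₄ ∷ []) → A
    five-blocks⇒found {x₀} {x₁} {x₂} {x₃} {x₄} hole@(w ∉∷ u) = conclude
      (derive [] _ _ 4 4 _ starRefutation [] ((5≤5+ , [] , AllPairs.tail u) ∷ [])
        single refl (AllPairs.tail u))
      where
      open Labelled (at x₀ (x₀ ∷ x₁ ∷ x₂ ∷ x₃ ∷ x₄ ∷ []))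

      centre : ∀ c → Any (All Holds) (stars c) → A
      centre c (here (e₁ ∷ e₂ ∷ e₃ ∷ e₄ ∷ [])) = star⇒found c hole (e₁ ∷ e₂ ∷ e₃ ∷ e₄ ∷ [])
      centre c (there (here (e₀ ∷ e₂ ∷ e₃ ∷ e₄ ∷ []))) = star⇒found c
        (HasHole-↭ (↭.shift x₁ [ x₀ ] (x₂ ∷ x₃ ∷ x₄ ∷ [])) hole)
        (trans (col-sym x₁ x₀) e₀ ∷ e₂ ∷ e₃ ∷ e₄ ∷ [])
      centre c (there (there (here (e₀ ∷ e₁ ∷ e₃ ∷ e₄ ∷ [])))) = star⇒found c
        (HasHole-↭ (↭.shift x₂ (x₀ ∷ x₁ ∷ []) (x₃ ∷ x₄ ∷ [])) hole)
        (trans (col-sym x₂ x₀) e₀ ∷ trans (col-sym x₂ x₁) e₁ ∷ e₃ ∷ e₄ ∷ [])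
      centre c (there (there (there (here (e₀ ∷ e₁ ∷ e₂ ∷ e₄ ∷ []))))) = star⇒found c
        (HasHole-↭ (↭.shift x₃ (x₀ ∷ x₁ ∷ x₂ ∷ []) (x₄ ∷ [])) hole)
        (trans (col-sym x₃ x₀) e₀ ∷ trans (col-sym x₃ x₁) e₁ ∷ trans (col-sym x₃ x₂) e₂ ∷ e₄ ∷ [])
      centre c (there (there (there (there (here (e₀ ∷ e₁ ∷ e₂ ∷ e₃ ∷ [])))))) = star⇒found c
        (HasHole-↭ (↭.shift x₄ (x₀ ∷ x₁ ∷ x₂ ∷ x₃ ∷ []) []) hole)
        (trans (col-sym x₄ x₀) e₀ ∷ trans (col-sym x₄ x₁) e₁ ∷ trans (col-sym x₄ x₂) e₂ ∷
         trans (col-sym x₄ x₃) e₃ ∷ [])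

      conclude : A ⊎ Any (All Holds) (stars red ++ stars blue) → A
      conclude (inj₁ found) = found
      conclude (inj₂ any) with Any.++⁻ (stars red) any
      ... | inj₁ c = centre red c
      ... | inj₂ c = centre blue c

-- Finite subsets, images and fresh vertices

module _ {N : ℕ} {P : Pred (Fin N) 0ℓ} (P? : Decidable P) where

  ∈⟦⟧⁺ : ∀ {v} → P v → v ∈ˢ ⟦ P? ⟧
  ∈⟦⟧⁺ {v} p = Vec.lookup⇒[]= v _ (trans (Vec.lookup∘tabulate _ v) (dec-true (P? v) p))

  ∈⟦⟧⁻ : ∀ {v} → v ∈ˢ ⟦ P? ⟧ → P v
  ∈⟦⟧⁻ {v} v∈ with P? v | trans (sym (Vec.lookup∘tabulate (does ∘ P?) v)) (Vec.[]=⇒lookup v∈)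
  ... | yes p | _ = p

⟦⟧-cong : ∀ {N} {P Q : Pred (Fin N) 0ℓ} (P? : Decidable P) (Q? : Decidable Q) →
          (∀ v → P v ⇔ Q v) → ⟦ P? ⟧ ≡ ⟦ Q? ⟧
⟦⟧-cong P? Q? P⇔Q = Vec.tabulate-cong (λ v → does-⇔ (P⇔Q v) (P? v) (Q? v))

∣⟦⟧∣-empty : ∀ {N} {P : Pred (Fin N) 0ℓ} (P? : Decidable P) → (∀ v → ¬ P v) → ∣ ⟦ P? ⟧ ∣ ≡ 0
∣⟦⟧∣-empty {zero}  P? ¬P = refl
∣⟦⟧∣-empty {suc N} P? ¬P with P? zero
... | yes p = ⊥-elim (¬P zero p)
... | no _  = ∣⟦⟧∣-empty (P? ∘ suc) (¬P ∘ suc)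

∣⟦⟧∣-insert : ∀ {N} {P Q : Pred (Fin N) 0ℓ} (P? : Decidable P) (Q? : Decidable Q) x →
              (∀ v → P v ⇔ (v ≡ x ⊎ Q v)) → ¬ Q x → ∣ ⟦ P? ⟧ ∣ ≡ suc ∣ ⟦ Q? ⟧ ∣
∣⟦⟧∣-insert P? Q? zero P⇔ ¬Qx with P? zero | Q? zero
... | no ¬p | _     = ⊥-elim (¬p (Equivalence.from (P⇔ zero) (inj₁ refl)))
... | yes _ | yes q = ⊥-elim (¬Qx q)
... | yes _ | no _  = cong (suc ∘ ∣_∣) (⟦⟧-cong (P? ∘ suc) (Q? ∘ suc) λ v → mk⇔
  (Sum.fromInj₂ (λ ()) ∘ Equivalence.to (P⇔ (suc v))) (Equivalence.from (P⇔ (suc v)) ∘ inj₂))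
∣⟦⟧∣-insert P? Q? (suc x) P⇔ ¬Qx with P? zero | Q? zero
... | yes _ | yes _ = cong suc (∣⟦⟧∣-insert (P? ∘ suc) (Q? ∘ suc) x (λ v → mk⇔
  (Sum.map₁ Fin.suc-injective ∘ Equivalence.to (P⇔ (suc v)))
  (Equivalence.from (P⇔ (suc v)) ∘ Sum.map₁ (cong suc))) ¬Qx)
... | no _  | no _  = ∣⟦⟧∣-insert (P? ∘ suc) (Q? ∘ suc) x (λ v → mk⇔
  (Sum.map₁ Fin.suc-injective ∘ Equivalence.to (P⇔ (suc v)))
  (Equivalence.from (P⇔ (suc v)) ∘ Sum.map₁ (cong suc))) ¬Qx
... | yes p | no ¬q with inj₂ q ← Equivalence.to (P⇔ zero) p = ⊥-elim (¬q q)
... | no ¬p | yes q = ⊥-elim (¬p (Equivalence.from (P⇔ zero) (inj₂ q)))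

module _ {M N} (f : Fin M → Fin N) (p : Subset M) where

  inImage? : Decidable (λ y → ∃ λ x → x ∈ˢ p × f x ≡ y)
  inImage? y = Fin.any? (λ x → (x ∈ˢ? p) ×-dec (f x Fin.≟ y))

  ∈-image⁺ : ∀ {x} → x ∈ˢ p → f x ∈ˢ image f p
  ∈-image⁺ x∈p = ∈⟦⟧⁺ inImage? (_ , x∈p , refl)

  ∈-image⁻ : ∀ {y} → y ∈ˢ image f p → ∃ λ x → x ∈ˢ p × f x ≡ y
  ∈-image⁻ = ∈⟦⟧⁻ inImage?

module _ {N : ℕ} where

  open DecMembership (Fin._≟_ {N}) using (_∈?_)

  elements : List (Fin N) → Subset N
  elements xs = ⟦ _∈? xs ⟧

  ∣elements∣ : ∀ {xs} → Unique xs → ∣ elements xs ∣ ≡ length xs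
  ∣elements∣ []                 = ∣⟦⟧∣-empty (_∈? []) (λ _ ())
  ∣elements∣ {x ∷ xs} (x∉ ∷ u) = trans
    (∣⟦⟧∣-insert (_∈? (x ∷ xs)) (_∈? xs) x
      (λ v → mk⇔ Any.toSum Any.fromSum)
      (All.All¬⇒¬Any x∉))
    (cong suc (∣elements∣ u))

  -- Pigeonhole: otherwise positions in `xs` would inject `Fin N` into a smaller set.
  fresh : ∀ {xs : List (Fin N)} → length xs < N → ∃ (_∉ xs)
  fresh {xs} xs<N with Fin.any? (λ v → ¬? (v ∈? xs))
  ... | yes v∉ = v∉
  ... | no ¬v∉ = ⊥-elim (Fin.<⇒notInjective xs<N index-injective)
    where
    v∈xs : ∀ v → v ∈ xs
    v∈xs v with v ∈? xs
    ... | yes v∈ = v∈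
    ... | no v∉  = ⊥-elim (¬v∉ (v , v∉))

    index-injective : Injective _≡_ _≡_ (Any.index ∘ v∈xs)
    index-injective {v} {v′} eq = trans (Any.lookup-index (v∈xs v))
      (trans (cong (lookup xs) eq) (sym (Any.lookup-index (v∈xs v′))))

  freshBlock : ∀ k {xs : List (Fin N)} → Unique xs → k + length xs ≤ N →
               ∃ λ (a : Vec (Fin N) k) → Unique (toList a ++ xs)
  freshBlock zero    u _ = [] , u
  freshBlock (suc k) {xs} u k+xs<N
    with a , ua ← freshBlock k u (ℕ.<⇒≤ k+xs<N)
    with v , v∉ ← fresh {toList a ++ xs} (subst (_< N)
      (sym (trans (List.length-++ (toList a)) (cong (_+ length xs) (Vec.length-toList a)))) k+xs<N)
    = v ∷ a , All.¬Any⇒All¬ _ v∉ ∷ ua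

-- Edges of the path in terms of quotients by s

module _ (s n : ℕ) (x : Fin ((n + 1) * s)) where

  private
    q = quotient {n + 1} s x
    r = remainder {n + 1} s x

    toℕ-split : toℕ x ≡ toℕ q * s + toℕ r
    toℕ-split = trans (cong toℕ (sym (Fin.combine-remQuot {n + 1} s x)))
      (trans (Fin.toℕ-combine q r) (cong (_+ toℕ r) (ℕ.*-comm s (toℕ q))))

    qs≤x : toℕ q * s ≤ toℕ x
    qs≤x = subst (toℕ q * s ≤_) (sym toℕ-split) (ℕ.m≤m+n _ _)

    x<q+1s : toℕ x < suc (toℕ q) * s
    x<q+1s = subst (_< suc (toℕ q) * s) (sym toℕ-split)
      (subst (toℕ q * s + toℕ r <_) (ℕ.+-comm _ s) (ℕ.+-monoʳ-< (toℕ q * s) (Fin.toℕ<n r)))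

  -- The interval from is to (i + 2)s consists of two intervals of length s, on which the quotient
  -- is i and i + 1.
  inBlock⁻ : ∀ {i} → InBlock s n i x → toℕ q ≡ toℕ i ⊎ toℕ q ≡ suc (toℕ i)
  inBlock⁻ {i} (is≤x , x<i+2s) with ℕ.m≤n⇒m<n∨m≡n i≤q
    where
    i≤q : toℕ i ≤ toℕ q
    i≤q = ℕ.≤-pred (ℕ.*-cancelʳ-< s (toℕ i) (suc (toℕ q)) (ℕ.≤-<-trans is≤x x<q+1s))
  ... | inj₂ i≡q = inj₁ (sym i≡q)
  ... | inj₁ i<q = inj₂ (ℕ.≤-antisym (ℕ.≤-pred (subst (toℕ q <_) (ℕ.+-comm (toℕ i) 2)
          (ℕ.*-cancelʳ-< s (toℕ q) (toℕ i + 2) (ℕ.≤-<-trans qs≤x x<i+2s)))) i<q)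

  inBlock⁺ : ∀ {i} → toℕ q ≡ toℕ i ⊎ toℕ q ≡ suc (toℕ i) → InBlock s n i x
  inBlock⁺ {i} q≡ = ℕ.≤-trans (ℕ.*-monoˡ-≤ s (lower q≡)) qs≤x ,
                    ℕ.<-≤-trans x<q+1s (ℕ.*-monoˡ-≤ s (upper q≡))
    where
    lower : toℕ q ≡ toℕ i ⊎ toℕ q ≡ suc (toℕ i) → toℕ i ≤ toℕ q
    lower (inj₁ eq) = ℕ.≤-reflexive (sym eq)
    lower (inj₂ eq) = subst (toℕ i ≤_) (sym eq) (ℕ.n≤1+n _)

    upper : toℕ q ≡ toℕ i ⊎ toℕ q ≡ suc (toℕ i) → suc (toℕ q) ≤ toℕ i + 2
    upper (inj₁ eq) = subst (_≤ toℕ i + 2) (cong suc (sym eq))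
      (subst (suc (toℕ i) ≤_) (ℕ.+-comm 2 (toℕ i)) (ℕ.n≤1+n _))
    upper (inj₂ eq) = subst (_≤ toℕ i + 2) (cong suc (sym eq))
      (ℕ.≤-reflexive (ℕ.+-comm 2 (toℕ i)))

-- Copies of paths from paths of blocks

module BlockPaths (s N : ℕ) (χ : Colouring (complete (2 * s) N)) where

  open Blocks {Fin N} {s}

  open DecMembership (Fin._≟_ {N}) using (_∈?_)

  edge : Block → Block → Subset N
  edge a b = elements (toList a ++ toList b)

  edge-sym : ∀ a b → edge a b ≡ edge b a
  edge-sym a b = ⟦⟧-cong (_∈? (toList a ++ toList b)) (_∈? (toList b ++ toList a))
    λ v → mk⇔ (Any.++-comm (toList a) (toList b)) (Any.++-comm (toList b) (toList a))

  ∣edge∣ : ∀ a b → Unique (toList a ++ toList b) → ∣ edge a b ∣ ≡ 2 * s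
  ∣edge∣ a b u = trans (∣elements∣ u) (trans (List.length-++ (toList a))
    (cong₂ _+_ (Vec.length-toList a) (trans (Vec.length-toList b) (sym (ℕ.+-identityʳ s)))))

  -- Sets of the wrong size, which are not edges, are red.
  colour : Subset N → Colour
  colour e with ∣ e ∣ ≟ 2 * s
  ... | yes ∣e∣≡2s = χ e ∣e∣≡2s
  ... | no _       = red

  -- `χ` also takes a proof of the size, but such proofs are all equal.
  colour-edge : ∀ {c} e (∣e∣≡2s : ∣ e ∣ ≡ 2 * s) → colour e ≡ c → χ e ∣e∣≡2s ≡ c
  colour-edge e ∣e∣≡2s eq with ∣ e ∣ ≟ 2 * s
  ... | yes p = trans (cong (χ e) (ℕ.≡-irrelevant ∣e∣≡2s p)) eq
  ... | no ¬p = ⊥-elim (¬p ∣e∣≡2s)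

  col : Block → Block → Colour
  col a b = colour (edge a b)

  col-sym : ∀ a b → col a b ≡ col b a
  col-sym a b = cong colour (edge-sym a b)

  BlockPath : Colour → ℕ → Set
  BlockPath c l = ∃ λ L → length L ≡ l × Separated L × Path col c L

  -- Vertex qs + r of the path goes to coordinate r of block q.
  copy : ∀ {c n} → BlockPath c (n + 1) → Copy (path s n) (colourClass (complete (2 * s) N) χ c)
  copy {c} {n} (L , len , sep , linked) = record
    { embed     = embed
    ; injective = injective
    ; edges     = λ { (i , refl) → monochromatic i }
    }
    where
    block : Fin (n + 1) → Block
    block i = lookup L (cast (sym len) i)

    embed : Fin ((n + 1) * s) → Fin N
    embed x = Vec.lookup (block (quotient {n + 1} s x)) (remainder {n + 1} s x)

    injective : Injective _≡_ _≡_ embed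
    injective {x} {y} eq with lookup-separated L sep _ _ eq
    ... | q≡ , r≡ = trans (sym (Fin.combine-remQuot {n + 1} s x))
      (trans (cong₂ combine (cast-injective q≡) r≡) (Fin.combine-remQuot {n + 1} s y))
      where
      cast-injective : ∀ {i j : Fin (n + 1)} → cast (sym len) i ≡ cast (sym len) j → i ≡ j
      cast-injective {i} {j} eq = Fin.toℕ-injective
        (trans (sym (Fin.toℕ-cast (sym len) i)) (trans (cong toℕ eq) (Fin.toℕ-cast (sym len) j)))

    embed-combine : ∀ q r → embed (combine q r) ≡ Vec.lookup (block q) r
    embed-combine q r = cong (λ (q , r) → Vec.lookup (block q) r) (Fin.remQuot-combine q r)

    monochromatic : ∀ i →
      Edge (colourClass (complete (2 * s) N) χ c) (image embed (pathEdge s n i))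
    monochromatic i = subst (Edge (colourClass (complete (2 * s) N) χ c)) (sym image≡edge)
      (∣edge∣ (block first) (block second) u , colour-edge _ _ e)
      where
      first second : Fin (n + 1)
      first  = fromℕ< (ℕ.<-trans (Fin.toℕ<n i) (ℕ.≤-reflexive (ℕ.+-comm 1 n)))
      second = fromℕ< (ℕ.≤-trans (s≤s (Fin.toℕ<n i)) (ℕ.≤-reflexive (ℕ.+-comm 1 n)))

      toℕ-first : toℕ first ≡ toℕ i
      toℕ-first = Fin.toℕ-fromℕ< _

      toℕ-second : toℕ second ≡ suc (toℕ i)
      toℕ-second = Fin.toℕ-fromℕ< _

      adjacent : Unique (toList (block first) ++ toList (block second)) ×
                 Joined col c (block first) (block second)
      adjacent = lookup-linked L sep linked _ _
        (trans (Fin.toℕ-cast (sym len) second) (trans toℕ-second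
          (cong suc (sym (trans (Fin.toℕ-cast (sym len) first) toℕ-first)))))

      u = proj₁ adjacent
      e = proj₂ adjacent

      image≡edge : image embed (pathEdge s n i) ≡ edge (block first) (block second)
      image≡edge = ⟦⟧-cong (inImage? embed (pathEdge s n i))
        (_∈? (toList (block first) ++ toList (block second)))
        λ v → mk⇔ to from
        where
        to : ∀ {v} → ∃ (λ x → x ∈ˢ pathEdge s n i × embed x ≡ v) →
             v ∈ toList (block first) ++ toList (block second)
        to (x , x∈ , refl) with inBlock⁻ s n x (∈⟦⟧⁻ (inBlock? s n i) x∈)
        ... | inj₁ q≡ rewrite Fin.toℕ-injective {j = first} (trans q≡ (sym toℕ-first)) =
          ∈.∈-++⁺ˡ (∈-lookup (block first) (remainder {n + 1} s x))
        ... | inj₂ q≡ rewrite Fin.toℕ-injective {j = second} (trans q≡ (sym toℕ-second)) =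
          ∈.∈-++⁺ʳ (toList (block first)) (∈-lookup (block second) (remainder {n + 1} s x))

        preimage : ∀ {v} q → toℕ q ≡ toℕ i ⊎ toℕ q ≡ suc (toℕ i) → v ∈ toList (block q) →
                   ∃ λ x → x ∈ˢ pathEdge s n i × embed x ≡ v
        preimage q q≡ v∈ with r , refl ← toList-lookup {a = block q} v∈ =
          combine q r ,
          ∈⟦⟧⁺ (inBlock? s n i) (inBlock⁺ s n (combine q r)
            (subst (λ q → toℕ q ≡ toℕ i ⊎ toℕ q ≡ suc (toℕ i))
                   (sym (cong proj₁ (Fin.remQuot-combine q r))) q≡)) ,
          embed-combine q r

        from : ∀ {v} → v ∈ toList (block first) ++ toList (block second) →
               ∃ λ x → x ∈ˢ pathEdge s n i × embed x ≡ v
        from v∈ with ∈.∈-++⁻ (toList (block first)) v∈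
        ... | inj₁ v∈first  = preimage first (inj₁ toℕ-first) v∈first
        ... | inj₂ v∈second = preimage second (inj₂ toℕ-second) v∈second

  -- The upper bound, by induction on the length

  freshHole : ∀ L → Separated L → length L * s < N → HasHole L
  freshHole L sep L<N with v , v∉ ← fresh (subst (_< N) (sym (length-vertexList L)) L<N) =
    v ∉∷ (All.¬Any⇒All¬ _ v∉ ∷ sep)

  extendSeparated : ∀ L → Separated L → suc (length L) * s ≤ N → ∃ λ a → Separated (a ∷ L)
  extendSeparated L sep ≤N = freshBlock s sep
    (subst (λ l → s + l ≤ N) (sym (length-vertexList L)) ≤N)

  separatedBlocks : ∀ k → k * s ≤ N → ∃ λ L → length L ≡ k × Separated L
  separatedBlocks zero    _    = [] , refl , []
  separatedBlocks (suc k) sk≤N with separatedBlocks k (ℕ.≤-trans (ℕ.m≤n+m (k * s) s) sk≤N)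
  ... | L , refl , sep with a , sep′ ← extendSeparated L sep sk≤N = a ∷ L , refl , sep′

  fiveBlockPath : 5 * s < N → (∃ λ L → length L ≡ 5 × Separated L) →
                  BlockPath red 5 ⊎ BlockPath blue 5
  fiveBlockPath 5s<N (L@(_ ∷ _ ∷ _ ∷ _ ∷ _ ∷ []) , refl , sep) =
    FiveBlocks.five-blocks⇒found col col-sym
      (λ {L} len u l → inj₁ (L , len , u , l)) (λ {L} len u l → inj₂ (L , len , u , l))
      (freshHole L sep 5s<N)

  -- For n = 4 + k the red path has 5 + k blocks. The strict inequality provides the free vertex
  -- beside them that the exchanges go through.
  blockPath : ∀ k → (5 + k) * s < N → BlockPath red (5 + k) ⊎ BlockPath blue 5
  blockPath zero 5s<N = fiveBlockPath 5s<N (separatedBlocks 5 (ℕ.<⇒≤ 5s<N))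
  blockPath (suc k) 6+ks<N with blockPath k (ℕ.≤-<-trans (ℕ.m≤n+m ((5 + k) * s) s) 6+ks<N)
  ... | inj₂ blues = inj₂ blues
  ... | inj₁ (L@(_ ∷ _ ∷ _ ∷ _ ∷ _ ∷ R) , refl , sep , reds)
    with a , sep′ ← extendSeparated L sep (ℕ.<⇒≤ 6+ks<N) =
    Search.extend⇒found col col-sym
      (λ {L} len u l → inj₁ (L , len , u , l)) (λ {L} len u l → inj₂ (L , len , u , l))
      refl (freshHole (a ∷ L) sep′ 6+ks<N) reds

arrows : ∀ s n → n ≥ 4 → Arrows ((n + 1) * s + 1) (path s n) (path s 4)
arrows s n@(suc (suc (suc (suc k)))) (s≤s (s≤s (s≤s (s≤s z≤n)))) χ =
  Sum.map (λ p → copy (subst (BlockPath red) (ℕ.+-comm 1 n) p)) copy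
    (blockPath k (subst (_< (n + 1) * s + 1) (cong (_* s) (ℕ.+-comm n 1))
      (ℕ.≤-reflexive (ℕ.+-comm 1 ((n + 1) * s)))))
  where
  open BlockPaths s ((n + 1) * s + 1) χ

-- The lower bound

starColouring : ∀ s M → Colouring (complete (2 * s) (suc M))
starColouring s M e _ with zero ∈ˢ? e
... | yes _ = blue
... | no _  = red

red⇒∉ : ∀ {s M} e ∣e∣ → starColouring s M e ∣e∣ ≡ red → ¬ zero ∈ˢ e
red⇒∉ e _ eq with zero ∈ˢ? e
... | no 0∉e = 0∉e

blue⇒∈ : ∀ {s M} e ∣e∣ → starColouring s M e ∣e∣ ≡ blue → zero ∈ˢ e
blue⇒∈ e _ eq with zero ∈ˢ? e
... | yes 0∈e = 0∈e

-- The first block lies in the first edge, and block `suc q` is the second half of edge `q`.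
vertex-in-edge : ∀ s n → n ≥ 1 → ∀ x → ∃ λ i → x ∈ˢ pathEdge s n i
vertex-in-edge s (suc n) _ x with quotient {suc n + 1} s x in eq
... | zero  = zero , ∈⟦⟧⁺ (inBlock? s (suc n) zero) (inBlock⁺ s (suc n) x (inj₁ (cong toℕ eq)))
... | suc q = i , ∈⟦⟧⁺ (inBlock? s (suc n) i)
    (inBlock⁺ s (suc n) x (inj₂ (trans (cong toℕ eq)
      (cong suc (sym (Fin.toℕ-cast (ℕ.+-comm n 1) q))))))
  where
  i : Fin (suc n)
  i = cast (ℕ.+-comm n 1) q

arrows⇒≤ : ∀ s n → s ≥ 1 → n ≥ 4 → ∀ M → Arrows M (path s n) (path s 4) →
           (n + 1) * s + 1 ≤ M
-- Without vertices there is none to fix, but as s ≥ 1 the paths have a vertex that cannot be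
-- embedded.
arrows⇒≤ (suc s) (suc n) _ _ zero arr with arr (λ _ _ → red)
... | inj₁ c = ⊥-elim (Fin.¬Fin0 (Copy.embed c zero))
... | inj₂ c = ⊥-elim (Fin.¬Fin0 (Copy.embed c zero))
arrows⇒≤ s n s≥1 n≥4 (suc M) arr with arr (starColouring s M)
-- A red copy avoids vertex `zero`; punching it out embeds the (n + 1)s vertices of the path into
-- `Fin M`.
... | inj₁ c = subst (_≤ suc M) (ℕ.+-comm 1 _)
      (s≤s (Fin.injective⇒≤ {f = λ x → punchOut (embed≢0 x)}
        (injective ∘ Fin.punchOut-injective (embed≢0 _) (embed≢0 _))))
  where
  open Copy c
  embed≢0 : ∀ x → zero ≢ embed x
  embed≢0 x 0≡ with i , x∈ ← vertex-in-edge s n (ℕ.≤-trans (s≤s z≤n) n≥4) x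
    with ∣e∣ , isRed ← edges (i , refl) =
    red⇒∉ _ ∣e∣ isRed (subst (_∈ˢ image embed (pathEdge s n i)) (sym 0≡)
      (∈-image⁺ embed (pathEdge s n i) x∈))
-- The first and third edges of a blue copy both pass through `zero`, hence share its preimage,
-- although one ends at 2s where the other begins.
... | inj₂ c = ⊥-elim (firstThirdDisjoint
        (Copy.injective c (trans (proj₂ (proj₂ first)) (sym (proj₂ (proj₂ third)))))
        (proj₁ (proj₂ first)) (proj₁ (proj₂ third)))
  where
  open Copy c

  preimage : ∀ i → ∃ λ x → x ∈ˢ pathEdge s 4 i × embed x ≡ zero
  preimage i with ∣e∣ , isBlue ← edges (i , refl) =
    ∈-image⁻ embed (pathEdge s 4 i) (blue⇒∈ _ ∣e∣ isBlue)

  first = preimage zero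
  third = preimage (suc (suc zero))

  firstThirdDisjoint : ∀ {x y} → x ≡ y →
    x ∈ˢ pathEdge s 4 zero → ¬ y ∈ˢ pathEdge s 4 (suc (suc zero))
  firstThirdDisjoint refl x∈ y∈ = ℕ.<⇒≱ (proj₂ (∈⟦⟧⁻ (inBlock? s 4 zero) x∈))
    (proj₁ (∈⟦⟧⁻ (inBlock? s 4 (suc (suc zero))) y∈))

theorem2 : ∀ (s n : ℕ) → s ≥ 1 → n ≥ 4 →
    RamseyNumber (path s n) (path s 4) ((n + 1) * s + 1)
theorem2 s n s≥1 n≥4 = arrows s n n≥4 , arrows⇒≤ s n s≥1 n≥4
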